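{- The meta-logic $\mathcal{M}_{\mathrm{IPL}}$ is sound for intuitionistic propositional logic (IPL). That is, for all IPL formulae $A_1,\ldots,A_m,B$: for every $\mathcal{M}_{\mathrm{IPL}}$-proof of $[\![B]\!]$ from $[\![A_1]\!],\ldots,[\![A_m]\!]$, there is an IPL-proof of $B$ from $A_1,\ldots,A_m$.
   Context: **The meta-logic $\mathcal{M}$** (a fragment of intuitionistic higher-order logic). Types: basic types, including the type $prop$ of propositions, and function types $\sigma\to\tau$. Terms: those of the simply typed $\lambda$-calculus (constants, variables, abstractions, applications; variables of every type are available); $a(b_1,\ldots,b_k)$ means $(\cdots(a\,b_1)\cdots b_k)$. A (meta-)formula is a term of type $prop$. Logical constants, for every type $\sigma$: $\Rightarrow\;: prop\to(prop\to prop)$, $\bigwedge_\sigma : (\sigma\to prop)\to prop$, $\equiv_\sigma : \sigma\to(\sigma\to prop)$. One writes $\bigwedge x.\phi$ for $\bigwedge_\sigma(\lambda x.\phi)$ with $x:\sigma$; $\Rightarrow$ associates to the right; the scope of a binder extends as far right as possible; $\phi[b/x]$ is capture-avoiding substitution. Inference rules of $\mathcal{M}$ (natural deduction; $\phi,\psi$ are formulae; "assumptions" means the undischarged assumptions on which the premise depends): - $\Rightarrow$-introduction: from a proof of $\psi$ from assumption $\phi$, infer $\phi\Rightarrow\psi$, discharging $\phi$. $\Rightarrow$-elimination: from $\phi\Rightarrow\psi$ and $\phi$ infer $\psi$. - $\bigwedge$-introduction: from $\phi$ infer $\bigwedge x.\phi$, provided $x$ is not free in the assumptions. $\bigwedge$-elimination: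 from $\bigwedge x.\phi$ infer $\phi[b/x]$, for any term $b$ of the type of $x$. - Equality: $a\equiv a$; from $a\equiv b$ infer $b\equiv a$; from $a\equiv b$ and $b\equiv c$ infer $a\equiv c$. - $\lambda$-conversions: $(\lambda x.a)\equiv(\lambda y.a[y/x])$ if $y$ is not free in $a$; $((\lambda x.a)(b))\equiv a[b/x]$; extensionality: from $f(x)\equiv g(x)$ infer $f\equiv g$, if $x$ is not free in the assumptions, $f$, or $g$. - Abstraction: from $a\equiv b$ infer $(\lambda x.a)\equiv(\lambda x.b)$, if $x$ is not free in the assumptions. Combination: from $f\equiv g$ and $a\equiv b$ infer $f(a)\equiv g(b)$. - Logical equivalence: from a proof of $\psi$ from assumption $\phi$ and a proof of $\phi$ from assumption $\psi$, infer $\phi\equiv\psi$, discharging these assumptions; from $\phi\equiv\psi$ and $\phi$ infer $\psi$. **The object-logic IPL.** Formulae are built from propositional variables and $\bot$ by the binary connectives $\&,\vee,\supset$. The natural deduction rules are: - $\&$I: from $A$ and $B$ infer $A\,\&\,B$. $\&$E: from $A\,\&\,B$ infer $A$; from $A\,\&\,B$ infer $B$. - $\vee$I: from $A$ infer $A\vee B$; from $B$ infer $A\vee B$. $\vee$E: from $A\vee B$, a proof of $C$ from assumption $A$, and a proof of $C$ from assumption $B$, infer $C$, discharging these assumptions. - $\supset$I: from a proof of $B$ from assumption $A$ infer $A\supset B$, discharging $A$. $\supset$E: from $A\supset B$ and $A$ infer $B$. - $\bot$E: from $\bot$ infer $A$. An IPL-proof of $B$ from $A_1,\ldots,A_m$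 is a natural deduction with conclusion $B$ all of whose undischarged assumptions are among $A_1,\ldots,A_m$. **The extension $\mathcal{M}_{\mathrm{IPL}}$** is $\mathcal{M}$ together with a basic type $form$, constants $\bot: form$; $\&,\vee,\supset\;: form\to(form\to form)$; $\mathrm{true}: form\to prop$; and the axioms below, where $A,B,C$ are variables of type $form$ and $[\![A]\!]$ abbreviates $\mathrm{true}(A)$: - ($\&$I) $\bigwedge A\,B.\;[\![A]\!]\Rightarrow([\![B]\!]\Rightarrow[\![A\,\&\,B]\!])$ - ($\&$E) $\bigwedge A\,B.\;[\![A\,\&\,B]\!]\Rightarrow[\![A]\!]$ and $\bigwedge A\,B.\;[\![A\,\&\,B]\!]\Rightarrow[\![B]\!]$ - ($\vee$I) $\bigwedge A\,B.\;[\![A]\!]\Rightarrow[\![A\vee B]\!]$ and $\bigwedge A\,B.\;[\![B]\!]\Rightarrow[\![A\vee B]\!]$ - ($\vee$E) $\bigwedge A\,B\,C.\;[\![A\vee B]\!]\Rightarrow([\![A]\!]\Rightarrow[\![C]\!])\Rightarrow([\![B]\!]\Rightarrow[\![C]\!])\Rightarrow[\![C]\!]$ - ($\supset$I) $\bigwedge A\,B.\;([\![A]\!]\Rightarrow[\![B]\!])\Rightarrow[\![A\supset B]\!]$ - ($\supset$E) $\bigwedge A\,B.\;[\![A\supset B]\!]\Rightarrow[\![A]\!]\Rightarrow[\![B]\!]$ - ($\bot$E) $\bigwedge A.\;[\![\bot]\!]\Rightarrow[\![A]\!]$ An $\mathcal{M}_{\mathrm{IPL}}$-proof of $\psi$ from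 $\phi_1,\ldots,\phi_m$ is a deduction of $\psi$ by the rules of $\mathcal{M}$ and these axioms, with undischarged assumptions among $\phi_1,\ldots,\phi_m$. **Translation.** An IPL formula $A$ is read as the evident term of type $form$ (propositional variables being variables of type $form$), and $[\![A]\!]$ is the meta-formula $\mathrm{true}(A)$. -}

module Defs where

open import Data.List.Base using (List; []; _∷_; map)
open import Data.List.Membership.Propositional using (_∈_)
open import Data.Nat.Base using (ℕ)

infixr 7 _⇒_

data Type (B : Set) : Set where
  prop : Type B
  base : B → Type B
  _⇒_  : Type B → Type B → Type B

mapType : {A B : Set} → (A → B) → Type A → Type B
mapType f prop     = prop
mapType f (base b) = base (f b)
mapType f (σ ⇒ τ)  = mapType f σ ⇒ mapType f τ

-- The basic types other than prop and the non-logical constants.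
record Signature : Set₁ where
  field
    Base  : Set
    Const : Type Base → Set

module Meta (S : Signature) where
  open Signature S

  Ty : Set
  Ty = Type Base

  -- The types of the bound (or eigen-) variables in scope, innermost first.
  Ctx : Set
  Ctx = List Ty

  -- Besides those listed in the context, every scope contains countably many
  -- variables name 0, name 1, … of each type.  In particular [] is not an empty
  -- scope, and a term in Tm [] σ may have free variables of any type.
  data Var : Ctx → Ty → Set where
    name : ∀ {σ} → ℕ → Var [] σ
    new  : ∀ {Γ σ} → Var (σ ∷ Γ) σ
    old  : ∀ {Γ σ τ} → Var Γ σ → Var (τ ∷ Γ) σ

  infixl 9 _·_

  data Tm (Γ : Ctx) : Ty → Set where
    var : ∀ {σ} → Var Γ σ → Tm Γ σ
    con : ∀ {σ} → Const σ → Tm Γ σ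
    imp : Tm Γ (prop ⇒ prop ⇒ prop)
    all : ∀ σ → Tm Γ ((σ ⇒ prop) ⇒ prop)
    eq  : ∀ σ → Tm Γ (σ ⇒ σ ⇒ prop)
    ƛ   : ∀ {σ τ} → Tm (σ ∷ Γ) τ → Tm Γ (σ ⇒ τ)
    _·_ : ∀ {σ τ} → Tm Γ (σ ⇒ τ) → Tm Γ σ → Tm Γ τ

  Formula : Ctx → Set
  Formula Γ = Tm Γ prop

  infixr 5 _⟹_
  infix  6 _≡ᵐ_

  _⟹_ : ∀ {Γ} → Formula Γ → Formula Γ → Formula Γ
  φ ⟹ ψ = imp · φ · ψ

  ⋀ : ∀ {Γ} σ → Formula (σ ∷ Γ) → Formula Γ
  ⋀ σ φ = all σ · ƛ φ

  _≡ᵐ_ : ∀ {Γ σ} → Tm Γ σ → Tm Γ σ → Formula Γ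
  _≡ᵐ_ {σ = σ} a b = eq σ · a · b

  Ren : Ctx → Ctx → Set
  Ren Γ Δ = ∀ {σ} → Var Γ σ → Var Δ σ

  liftRen : ∀ {Γ Δ τ} → Ren Γ Δ → Ren (τ ∷ Γ) (τ ∷ Δ)
  liftRen ρ new     = new
  liftRen ρ (old x) = old (ρ x)

  rename : ∀ {Γ Δ σ} → Ren Γ Δ → Tm Γ σ → Tm Δ σ
  rename ρ (var x) = var (ρ x)
  rename ρ (con c) = con c
  rename ρ imp     = imp
  rename ρ (all σ) = all σ
  rename ρ (eq σ)  = eq σ
  rename ρ (ƛ a)   = ƛ (rename (liftRen ρ) a)
  rename ρ (f · a) = rename ρ f · rename ρ a

  weaken : ∀ {Γ σ τ} → Tm Γ σ → Tm (τ ∷ Γ) σ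
  weaken = rename old

  Sub : Ctx → Ctx → Set
  Sub Γ Δ = ∀ {σ} → Var Γ σ → Tm Δ σ

  liftSub : ∀ {Γ Δ τ} → Sub Γ Δ → Sub (τ ∷ Γ) (τ ∷ Δ)
  liftSub s new     = var new
  liftSub s (old x) = weaken (s x)

  subst : ∀ {Γ Δ σ} → Sub Γ Δ → Tm Γ σ → Tm Δ σ
  subst s (var x) = s x
  subst s (con c) = con c
  subst s imp     = imp
  subst s (all σ) = all σ
  subst s (eq σ)  = eq σ
  subst s (ƛ a)   = ƛ (subst (liftSub s) a)
  subst s (f · a) = subst s f · subst s a

  single : ∀ {Γ τ} → Tm Γ τ → Sub (τ ∷ Γ) Γ
  single b new     = b
  single b (old x) = var x

  infix 8 _[_]

  _[_] : ∀ {Γ σ τ} → Tm (τ ∷ Γ) σ → Tm Γ τ → Tm Γ σ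
  a [ b ] = subst (single b) a

  -- Φ contains (at least) the undischarged assumptions.  The side condition "x is
  -- not free in …" becomes: x is the newest variable and everything it must not
  -- occur in is weakened.
  module Deduction (Axiom : ∀ {Γ} → Formula Γ → Set) where

    infix 3 _⊢_

    data _⊢_ {Γ : Ctx} (Φ : List (Formula Γ)) : Formula Γ → Set where
      axiom : ∀ {φ} → Axiom φ → Φ ⊢ φ
      hyp   : ∀ {φ} → φ ∈ Φ → Φ ⊢ φ

      ⇒I : ∀ {φ ψ} → φ ∷ Φ ⊢ ψ → Φ ⊢ φ ⟹ ψ
      ⇒E : ∀ {φ ψ} → Φ ⊢ φ ⟹ ψ → Φ ⊢ φ → Φ ⊢ ψ
      ⋀I : ∀ {σ} {φ : Formula (σ ∷ Γ)} → map weaken Φ ⊢ φ → Φ ⊢ ⋀ σ φ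
      ⋀E : ∀ {σ} {φ : Formula (σ ∷ Γ)} → Φ ⊢ ⋀ σ φ → (b : Tm Γ σ) → Φ ⊢ φ [ b ]

      -- As bound variables are nameless, α-conversion is an instance of ≡-refl.
      ≡-refl  : ∀ {σ} {a : Tm Γ σ} → Φ ⊢ a ≡ᵐ a
      ≡-sym   : ∀ {σ} {a b : Tm Γ σ} → Φ ⊢ a ≡ᵐ b → Φ ⊢ b ≡ᵐ a
      ≡-trans : ∀ {σ} {a b c : Tm Γ σ} → Φ ⊢ a ≡ᵐ b → Φ ⊢ b ≡ᵐ c → Φ ⊢ a ≡ᵐ c

      β   : ∀ {σ τ} {a : Tm (σ ∷ Γ) τ} {b : Tm Γ σ} → Φ ⊢ ƛ a · b ≡ᵐ a [ b ]
      ext : ∀ {σ τ} {f g : Tm Γ (σ ⇒ τ)} →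
            map weaken Φ ⊢ weaken f · var new ≡ᵐ weaken g · var new → Φ ⊢ f ≡ᵐ g

      abstraction : ∀ {σ τ} {a b : Tm (σ ∷ Γ) τ} → map weaken Φ ⊢ a ≡ᵐ b → Φ ⊢ ƛ a ≡ᵐ ƛ b
      combination : ∀ {σ τ} {f g : Tm Γ (σ ⇒ τ)} {a b : Tm Γ σ} →
                    Φ ⊢ f ≡ᵐ g → Φ ⊢ a ≡ᵐ b → Φ ⊢ f · a ≡ᵐ g · b

      equivI : ∀ {φ ψ} → φ ∷ Φ ⊢ ψ → ψ ∷ Φ ⊢ φ → Φ ⊢ φ ≡ᵐ ψ
      equivE : ∀ {φ ψ} → Φ ⊢ φ ≡ᵐ ψ → Φ ⊢ φ → Φ ⊢ ψ

module IPL where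

  infixr 7 _&_
  infixr 6 _∨_
  infixr 5 _⊃_
  infix  3 _⊢_

  data Formula : Set where
    atom : ℕ → Formula
    ⊥    : Formula
    _&_ _∨_ _⊃_ : Formula → Formula → Formula

  data _⊢_ (Γ : List Formula) : Formula → Set where
    hyp : ∀ {A} → A ∈ Γ → Γ ⊢ A
    &I  : ∀ {A B} → Γ ⊢ A → Γ ⊢ B → Γ ⊢ A & B
    &E₁ : ∀ {A B} → Γ ⊢ A & B → Γ ⊢ A
    &E₂ : ∀ {A B} → Γ ⊢ A & B → Γ ⊢ B
    ∨I₁ : ∀ {A B} → Γ ⊢ A → Γ ⊢ A ∨ B
    ∨I₂ : ∀ {A B} → Γ ⊢ B → Γ ⊢ A ∨ B
    ∨E  : ∀ {A B C} → Γ ⊢ A ∨ B → A ∷ Γ ⊢ C → B ∷ Γ ⊢ C → Γ ⊢ C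
    ⊃I  : ∀ {A B} → A ∷ Γ ⊢ B → Γ ⊢ A ⊃ B
    ⊃E  : ∀ {A B} → Γ ⊢ A ⊃ B → Γ ⊢ A → Γ ⊢ B
    ⊥E  : ∀ {A} → Γ ⊢ ⊥ → Γ ⊢ A

-- S is whatever the meta-logic has before form and its constants are added.
module MIPL (S : Signature) where

  data Base : Set where
    form    : Base
    ambient : Signature.Base S → Base

  data Const : Type Base → Set where
    ⊥ᶜ    : Const (base form)
    &ᶜ    : Const (base form ⇒ base form ⇒ base form)
    ∨ᶜ    : Const (base form ⇒ base form ⇒ base form)
    ⊃ᶜ    : Const (base form ⇒ base form ⇒ base form)
    trueᶜ : Const (base form ⇒ prop)
    ambientᶜ : ∀ {σ} → Signature.Const S σ → Const (mapType ambient σ)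

  signature : Signature
  signature = record { Base = Base ; Const = Const }

  open Meta signature public

  Form : Ty
  Form = base form

  infixr 7 _&_
  infixr 6 _∨_
  infixr 5 _⊃_

  ⊥ : ∀ {Γ} → Tm Γ Form
  ⊥ = con ⊥ᶜ

  _&_ _∨_ _⊃_ : ∀ {Γ} → Tm Γ Form → Tm Γ Form → Tm Γ Form
  A & B = con &ᶜ · A · B
  A ∨ B = con ∨ᶜ · A · B
  A ⊃ B = con ⊃ᶜ · A · B

  True : ∀ {Γ} → Tm Γ Form → Formula Γ
  True A = con trueᶜ · A

  ⋀₁ : ∀ {Γ} → (Tm (Form ∷ Γ) Form → Formula (Form ∷ Γ)) → Formula Γ
  ⋀₁ φ = ⋀ Form (φ (var new))

  ⋀₂ : ∀ {Γ} → (let Δ = Form ∷ Form ∷ Γ in Tm Δ Form → Tm Δ Form → Formula Δ) → Formula Γ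
  ⋀₂ φ = ⋀ Form (⋀ Form (φ (var (old new)) (var new)))

  ⋀₃ : ∀ {Γ} → (let Δ = Form ∷ Form ∷ Form ∷ Γ in
       Tm Δ Form → Tm Δ Form → Tm Δ Form → Formula Δ) → Formula Γ
  ⋀₃ φ = ⋀ Form (⋀ Form (⋀ Form (φ (var (old (old new))) (var (old new)) (var new))))

  data Axiom {Γ : Ctx} : Formula Γ → Set where
    &I  : Axiom (⋀₂ λ A B → True A ⟹ True B ⟹ True (A & B))
    &E₁ : Axiom (⋀₂ λ A B → True (A & B) ⟹ True A)
    &E₂ : Axiom (⋀₂ λ A B → True (A & B) ⟹ True B)
    ∨I₁ : Axiom (⋀₂ λ A B → True A ⟹ True (A ∨ B))
    ∨I₂ : Axiom (⋀₂ λ A B → True B ⟹ True (A ∨ B))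
    ∨E  : Axiom (⋀₃ λ A B C →
            True (A ∨ B) ⟹ (True A ⟹ True C) ⟹ (True B ⟹ True C) ⟹ True C)
    ⊃I  : Axiom (⋀₂ λ A B → (True A ⟹ True B) ⟹ True (A ⊃ B))
    ⊃E  : Axiom (⋀₂ λ A B → True (A ⊃ B) ⟹ True A ⟹ True B)
    ⊥E  : Axiom (⋀₁ λ A → True ⊥ ⟹ True A)

  open Deduction Axiom public

  ⌜_⌝ : IPL.Formula → Tm [] Form
  ⌜ IPL.atom n ⌝ = var (name n)
  ⌜ IPL.⊥ ⌝      = ⊥
  ⌜ A IPL.& B ⌝  = ⌜ A ⌝ & ⌜ B ⌝
  ⌜ A IPL.∨ B ⌝  = ⌜ A ⌝ ∨ ⌜ B ⌝
  ⌜ A IPL.⊃ B ⌝  = ⌜ A ⌝ ⊃ ⌜ B ⌝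

  ⟦_⟧ : IPL.Formula → Formula []
  ⟦ A ⟧ = True ⌜ A ⌝

{-# OPTIONS --safe #-}
module Submission where

open import Data.Bool.Base using (Bool; true; false; T)
open import Data.Bool.Properties using (T?) renaming (_≟_ to _≟ᵇ_)
open import Data.Empty using () renaming (⊥ to Empty; ⊥-elim to absurd)
open import Data.Fin.Base using (Fin)
open import Data.Fin.Subset as Subset using (Subset; _⊆_; _∪_; ⁅_⁆)
open import Data.Fin.Subset.Properties
  using (p⊆p∪q; q⊆p∪q; x∈p∪q⁻; x∈⁅x⁆; x∈⁅y⁆⇒x≡y; ∉⊥; ∪-assoc)
  renaming (_∈?_ to _∈ˢ?_)
open import Data.Fin.Properties using () renaming (_≟_ to _≟ᶠ_)
open import Data.List.Base
  using (List; []; _∷_; _++_; map; concat; concatMap; filter; length; lookup; allFin;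
         cartesianProduct; cartesianProductWith)
open import Data.List.Membership.DecPropositional using () renaming (_∈?_ to mem?)
open import Data.List.Membership.Propositional using (_∈_)
open import Data.List.Membership.Propositional.Properties
  using (∈-map⁺; ∈-map⁻; ∈-++⁺ˡ; ∈-++⁺ʳ; ∈-++⁻; ∈-concat⁺′; ∈-concat⁻′; ∈-filter⁺; ∈-filter⁻;
         ∈-allFin; ∈-cartesianProduct⁺; ∈-cartesianProductWith⁺; ∈-cartesianProductWith⁻)
open import Data.List.Relation.Binary.Subset.Propositional using () renaming (_⊆_ to _⊆ˡ_)
open import Data.List.Relation.Binary.Subset.Propositional.Properties using (∷⁺ʳ)
open import Data.List.Relation.Unary.All as All using (All; []; _∷_)
open import Data.List.Relation.Unary.Any using (here; there; index)
open import Data.List.Relation.Unary.Any.Properties using (lookup-index)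
open import Data.Nat.Base using (ℕ; zero; suc)
open import Data.Nat.Properties using () renaming (_≟_ to _≟ⁿ_)
open import Data.Product.Base using (Σ; ∃; _×_; _,_; proj₁; proj₂; swap)
open import Data.Product.Properties using (≡-dec)
open import Data.Sum.Base using (_⊎_; inj₁; inj₂; [_,_]′)
open import Data.Unit.Base using (⊤; tt)
open import Data.Vec.Base using ([]; _∷_)
open import Data.Vec.Properties using () renaming (≡-dec to ≡-decᵛ)
open import Function.Base using (id; _∘_; const)
open import Relation.Binary.PropositionalEquality.Core using (_≡_; refl; sym; cong)
  renaming (subst to transport)
open import Relation.Nullary.Decidable.Core using (Dec; no; does; map′)
open import Defs

-- A finite Kripke-style model: prop and form both denote a finite implicative
-- meet-semilattice of sets of worlds, an ambient basic type denotes a point, and σ ⇒ τ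
-- denotes the functions that preserve the forced equality.  Every type then has, up to
-- forced equality, a finite list of elements, so the impredicative ⋀ is a finite meet
-- and ℳ is sound for the model.  Worlds are sets of subformulas of B and the Aᵢ, and
-- the values are intersections of sets {w | w , Δ ⊢ C}, where C is such a subformula;
-- by induction on C, the denotation of C is {w | w ⊢ C}.  Forcing of B at the
-- empty world (which assumes only the Aᵢ) is thus derivability of B from the Aᵢ.

-- Frames whose values form, up to forcing, a finite implicative semilattice.

record Frame : Set₁ where
  infix  4 _≤_ _⊩_
  infixr 6 _⇛_
  field
    World   : Set
    _≤_     : World → World → Set
    ≤-refl  : ∀ {w} → w ≤ w
    ≤-trans : ∀ {u v w} → u ≤ v → v ≤ w → u ≤ w
    Val     : Set
    _⊩_     : World → Val → Set
    ⊩-mono  : ∀ {w v p} → w ≤ v → w ⊩ p → v ⊩ p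
    _⇛_     : Val → Val → Val
    ⇛-intro : ∀ {w p q} → (∀ {v} → w ≤ v → v ⊩ p → v ⊩ q) → w ⊩ p ⇛ q
    ⇛-elim  : ∀ {w p q} → w ⊩ p ⇛ q → w ⊩ p → w ⊩ q
    ⋂       : List Val → Val
    ⋂-intro : ∀ {w ps} → (∀ {p} → p ∈ ps → w ⊩ p) → w ⊩ ⋂ ps
    ⋂-elim  : ∀ {w p ps} → w ⊩ ⋂ ps → p ∈ ps → w ⊩ p
    vals    : List Val
    -- The representative agrees with `p` at all worlds at once. Identity would be too much to ask:
    -- in the canonical frame many lists denote the same set of worlds.
    vals-complete : ∀ p → ∃ λ q → q ∈ vals × (∀ {w} → (w ⊩ p → w ⊩ q) × (w ⊩ q → w ⊩ p))

module FrameProperties (F : Frame) where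
  open Frame F public

  infix 4 _⊩_≋_

  _⊩_≋_ : World → Val → Val → Set
  w ⊩ p ≋ q = ∀ {v} → w ≤ v → (v ⊩ p → v ⊩ q) × (v ⊩ q → v ⊩ p)

  ≋-refl : ∀ {w p} → w ⊩ p ≋ p
  ≋-refl _ = id , id

  ≋-mono : ∀ {w v p q} → w ≤ v → w ⊩ p ≋ q → v ⊩ p ≋ q
  ≋-mono w≤v e v≤u = e (≤-trans w≤v v≤u)

  ⋂-map-intro : ∀ {A : Set} {f : A → Val} {w xs} →
                (∀ {x} → x ∈ xs → w ⊩ f x) → w ⊩ ⋂ (map f xs)
  ⋂-map-intro {f = f} {w} {xs} h = ⋂-intro go
    where
    go : ∀ {p} → p ∈ map f xs → w ⊩ p
    go p∈ with ∈-map⁻ f p∈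
    ... | _ , x∈xs , refl = h x∈xs

  ⋂-map-elim : ∀ {A : Set} (f : A → Val) {w xs x} → w ⊩ ⋂ (map f xs) → x ∈ xs → w ⊩ f x
  ⋂-map-elim f h x∈xs = ⋂-elim h (∈-map⁺ f x∈xs)

  ⋂-map-cong : ∀ {A : Set} (xs : List A) {f g : A → Val} {w} →
               (∀ x → w ⊩ f x ≋ g x) → w ⊩ ⋂ (map f xs) ≋ ⋂ (map g xs)
  ⋂-map-cong xs {f} {g} e w≤v =
    (λ h → ⋂-map-intro λ {x} x∈ → proj₁ (e x w≤v) (⋂-map-elim f h x∈)) ,
    (λ h → ⋂-map-intro λ {x} x∈ → proj₂ (e x w≤v) (⋂-map-elim g h x∈))

  ⇛-cong : ∀ {w p p′ q q′} → w ⊩ p ≋ p′ → w ⊩ q ≋ q′ → w ⊩ p ⇛ q ≋ p′ ⇛ q′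
  ⇛-cong e d w≤v =
    (λ h → ⇛-intro λ v≤u x → proj₁ (d (≤-trans w≤v v≤u))
      (⇛-elim (⊩-mono v≤u h) (proj₂ (e (≤-trans w≤v v≤u)) x))) ,
    (λ h → ⇛-intro λ v≤u x → proj₂ (d (≤-trans w≤v v≤u))
      (⇛-elim (⊩-mono v≤u h) (proj₁ (e (≤-trans w≤v v≤u)) x)))

  infixr 7 _⊓_
  infixr 6 _⊔_

  _⊓_ : Val → Val → Val
  p ⊓ q = ⋂ (p ∷ q ∷ [])

  ⊓-intro : ∀ {w p q} → w ⊩ p → w ⊩ q → w ⊩ p ⊓ q
  ⊓-intro x y = ⋂-intro λ { (here refl) → x ; (there (here refl)) → y }

  ⊓-elim₁ : ∀ {w p q} → w ⊩ p ⊓ q → w ⊩ p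
  ⊓-elim₁ h = ⋂-elim h (here refl)

  ⊓-elim₂ : ∀ {w p q} → w ⊩ p ⊓ q → w ⊩ q
  ⊓-elim₂ h = ⋂-elim h (there (here refl))

  ⊓-cong : ∀ {w p p′ q q′} → w ⊩ p ≋ p′ → w ⊩ q ≋ q′ → w ⊩ p ⊓ q ≋ p′ ⊓ q′
  ⊓-cong e d w≤v =
    (λ h → ⊓-intro (proj₁ (e w≤v) (⊓-elim₁ h)) (proj₁ (d w≤v) (⊓-elim₂ h))) ,
    (λ h → ⊓-intro (proj₂ (e w≤v) (⊓-elim₁ h)) (proj₂ (d w≤v) (⊓-elim₂ h)))

  -- Joins need not exist primitively: finiteness of vals makes the second-order
  -- definitions of ∨ and ⊥ available.
  _⊔_ : Val → Val → Val
  p ⊔ q = ⋂ (map (λ c → (p ⇛ c) ⇛ (q ⇛ c) ⇛ c) vals)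

  ⊔-intro : ∀ {w p q} → (∀ c → w ⊩ (p ⇛ c) ⇛ (q ⇛ c) ⇛ c) → w ⊩ p ⊔ q
  ⊔-intro h = ⋂-map-intro λ {c} _ → h c

  ⊔-cong : ∀ {w p p′ q q′} → w ⊩ p ≋ p′ → w ⊩ q ≋ q′ → w ⊩ p ⊔ q ≋ p′ ⊔ q′
  ⊔-cong e d = ⋂-map-cong vals λ c →
    ⇛-cong (⇛-cong e ≋-refl) (⇛-cong (⇛-cong d ≋-refl) ≋-refl)

  ⊔-intro₁ : ∀ {w p q} → w ⊩ p → w ⊩ p ⊔ q
  ⊔-intro₁ x = ⊔-intro λ _ → ⇛-intro λ w≤v f → ⇛-intro λ v≤u _ →
    ⊩-mono v≤u (⇛-elim f (⊩-mono w≤v x))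

  ⊔-intro₂ : ∀ {w p q} → w ⊩ q → w ⊩ p ⊔ q
  ⊔-intro₂ y = ⊔-intro λ _ → ⇛-intro λ w≤v _ → ⇛-intro λ v≤u g →
    ⇛-elim g (⊩-mono (≤-trans w≤v v≤u) y)

  -- The meet defining `_⊔_` ranges over `vals` only, so it is instantiated at a listed value `d`
  -- equivalent to `c`, and the result is carried back to `c`.
  ⊔-elim : ∀ {w p q} c → w ⊩ p ⊔ q → (∀ {v} → w ≤ v → v ⊩ p → v ⊩ c) →
           (∀ {v} → w ≤ v → v ⊩ q → v ⊩ c) → w ⊩ c
  ⊔-elim {p = p} {q} c h f g with vals-complete c
  ... | d , d∈ , c⇔d = proj₂ c⇔d (⇛-elim (⇛-elim (⋂-map-elim (λ c → (p ⇛ c) ⇛ (q ⇛ c) ⇛ c) h d∈)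
    (⇛-intro λ w≤v x → proj₁ c⇔d (f w≤v x)))
    (⇛-intro λ w≤v y → proj₁ c⇔d (g w≤v y)))

  ⋂vals-elim : ∀ {w} c → w ⊩ ⋂ vals → w ⊩ c
  ⋂vals-elim c h with vals-complete c
  ... | _ , d∈ , c⇔d = proj₂ c⇔d (⋂-elim h d∈)

-- Extensional function types with finitely many elements.

tables : {A B : Set} → List A → List B → List (List (A × B))
tables []       bs = [] ∷ []
tables (a ∷ as) bs = cartesianProductWith (λ b t → (a , b) ∷ t) bs (tables as bs)

∈-tables : {A B : Set} (f : A → B) (as : List A) {bs : List B} → (∀ a → f a ∈ bs) →
           map (λ a → a , f a) as ∈ tables as bs
∈-tables f []       f∈ = here refl
∈-tables f (a ∷ as) f∈ =
  ∈-cartesianProductWith⁺ (λ b t → (a , b) ∷ t) (f∈ a) (∈-tables f as f∈)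

module Interpretation (F : Frame) (S : Signature) where
  open FrameProperties F
  open MIPL S hiding (⟦_⟧)

  mutual
    El : Ty → Set
    El prop               = Val
    El (base form)        = Val
    El (base (ambient _)) = ⊤
    El (σ ⇒ τ)            =
      Σ (El σ → El τ) λ f → ∀ {w a b} → Eq σ w a b → Eq τ w (f a) (f b)

    -- Functions are compared at a common argument and at `w` alone. Preservation of equality, built
    -- into `El`, extends this to equal arguments, and `Eq-mono` to later worlds.
    Eq : ∀ σ → World → El σ → El σ → Set
    Eq prop               w p q = w ⊩ p ≋ q
    Eq (base form)        w p q = w ⊩ p ≋ q
    Eq (base (ambient _)) w _ _ = ⊤
    Eq (σ ⇒ τ)            w f g = ∀ a → Eq τ w (proj₁ f a) (proj₁ g a)

  Eq-refl : ∀ σ {w a} → Eq σ w a a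
  Eq-refl prop               = ≋-refl
  Eq-refl (base form)        = ≋-refl
  Eq-refl (base (ambient _)) = tt
  Eq-refl (σ ⇒ τ)            = λ _ → Eq-refl τ

  Eq-sym : ∀ σ {w a b} → Eq σ w a b → Eq σ w b a
  Eq-sym prop               e = swap ∘ e
  Eq-sym (base form)        e = swap ∘ e
  Eq-sym (base (ambient _)) _ = tt
  Eq-sym (σ ⇒ τ)            e = λ a → Eq-sym τ (e a)

  Eq-trans : ∀ σ {w a b c} → Eq σ w a b → Eq σ w b c → Eq σ w a c
  Eq-trans prop               e d = λ w≤v → proj₁ (d w≤v) ∘ proj₁ (e w≤v) , proj₂ (e w≤v) ∘ proj₂ (d w≤v)
  Eq-trans (base form)        e d = λ w≤v → proj₁ (d w≤v) ∘ proj₁ (e w≤v) , proj₂ (e w≤v) ∘ proj₂ (d w≤v)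
  Eq-trans (base (ambient _)) _ _ = tt
  Eq-trans (σ ⇒ τ)            e d = λ a → Eq-trans τ (e a) (d a)

  Eq-mono : ∀ σ {w v a b} → w ≤ v → Eq σ w a b → Eq σ v a b
  Eq-mono prop               w≤v e = ≋-mono w≤v e
  Eq-mono (base form)        w≤v e = ≋-mono w≤v e
  Eq-mono (base (ambient _)) _   _ = tt
  Eq-mono (σ ⇒ τ)            w≤v e = λ a → Eq-mono τ w≤v (e a)

  -- "The value u x wherever the condition h x holds", which makes sense at every
  -- type because every type is, pointwise, a power of Val.
  mutual
    glue : ∀ τ {A : Set} → List A → (A → Val) → (A → El τ) → El τ
    glue prop               xs h u = ⋂ (map (λ x → h x ⇛ u x) xs)
    glue (base form)        xs h u = ⋂ (map (λ x → h x ⇛ u x) xs)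
    glue (base (ambient _)) xs h u = tt
    glue (σ ⇒ τ)            xs h u =
      (λ a → glue τ xs h (λ x → proj₁ (u x) a)) ,
      (λ e → glue-cong τ xs (λ _ → ≋-refl) (λ x → proj₂ (u x) e))

    glue-cong : ∀ τ {A : Set} (xs : List A) {h h′ : A → Val} {u u′ : A → El τ} {w} →
                (∀ x → w ⊩ h x ≋ h′ x) → (∀ x → Eq τ w (u x) (u′ x)) →
                Eq τ w (glue τ xs h u) (glue τ xs h′ u′)
    glue-cong prop               xs e d = ⋂-map-cong xs λ x → ⇛-cong (e x) (d x)
    glue-cong (base form)        xs e d = ⋂-map-cong xs λ x → ⇛-cong (e x) (d x)
    glue-cong (base (ambient _)) xs e d = tt
    glue-cong (σ ⇒ τ)            xs e d = λ a → glue-cong τ xs e (λ x → d x a)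

  -- From the meet, the given `x` with `h x` forced yields `u x`, hence `t`. Conversely `t` yields
  -- every `u z` wherever `h z` comes to hold, because all applicable members agree with `t`.
  ⋂-glue : ∀ {A : Set} (xs : List A) {h u : A → Val} t {w} →
           (∀ {x} → x ∈ xs → ∀ {v} → w ≤ v → v ⊩ h x → v ⊩ u x ≋ t) →
           (∃ λ x → x ∈ xs × w ⊩ h x) → w ⊩ ⋂ (map (λ x → h x ⇛ u x) xs) ≋ t
  ⋂-glue xs {h} {u} t e (x , x∈ , hx) w≤v =
    (λ g → proj₁ (e x∈ w≤v (⊩-mono w≤v hx) ≤-refl)
             (⇛-elim (⋂-map-elim (λ x → h x ⇛ u x) g x∈) (⊩-mono w≤v hx))) ,
    (λ y → ⋂-map-intro λ z∈ → ⇛-intro λ v≤v′ hz →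
             proj₂ (e z∈ (≤-trans w≤v v≤v′) hz ≤-refl) (⊩-mono v≤v′ y))

  glue-Eq : ∀ τ {A : Set} (xs : List A) {h : A → Val} {u : A → El τ} t {w} →
            (∀ {x} → x ∈ xs → ∀ {v} → w ≤ v → v ⊩ h x → Eq τ v (u x) t) →
            (∃ λ x → x ∈ xs × w ⊩ h x) → Eq τ w (glue τ xs h u) t
  glue-Eq prop               xs t e x = ⋂-glue xs t e x
  glue-Eq (base form)        xs t e x = ⋂-glue xs t e x
  glue-Eq (base (ambient _)) xs t e x = tt
  glue-Eq (σ ⇒ τ)            xs t e x =
    λ a → glue-Eq τ xs (proj₁ t a) (λ x∈ w≤v hx → e x∈ w≤v hx a) x

  -- Gluing the empty family gives the empty meet, pointwise at function types: an inhabitant of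
  -- every type.
  default : ∀ σ → El σ
  default σ = glue σ {Empty} [] absurd absurd

  equiv : Val → Val → Val
  equiv p q = (p ⇛ q) ⊓ (q ⇛ p)

  equiv-intro : ∀ {w p q} → w ⊩ p ≋ q → w ⊩ equiv p q
  equiv-intro e = ⊓-intro (⇛-intro λ w≤v → proj₁ (e w≤v)) (⇛-intro λ w≤v → proj₂ (e w≤v))

  equiv-elim : ∀ {w p q} → w ⊩ equiv p q → w ⊩ p ≋ q
  equiv-elim h w≤v = ⇛-elim (⊩-mono w≤v (⊓-elim₁ h)) , ⇛-elim (⊩-mono w≤v (⊓-elim₂ h))

  mutual
    elems : ∀ σ → List (El σ)
    elems prop               = vals
    elems (base form)        = vals
    elems (base (ambient _)) = tt ∷ []
    elems (σ ⇒ τ)            = map fromTable (tables (elems σ) (elems τ))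

    -- Definition by cases on forced equality with the keys of the table. Keys may become equal at
    -- later worlds, so several rows can apply at once; gluing accommodates this.
    fromTable : ∀ {σ τ} → List (El σ × El τ) → El (σ ⇒ τ)
    fromTable {σ} {τ} t =
      (λ a → glue τ t (λ x → eqv σ a (proj₁ x)) proj₂) ,
      (λ e → glue-cong τ t (λ x → eqv-congˡ σ e) (λ _ → Eq-refl τ))

    -- The relation `Eq` internalised as a value. At function types it quantifies over all
    -- arguments, which is a finite meet thanks to `elems`; hence the mutual recursion with the
    -- enumeration.
    eqv : ∀ σ → El σ → El σ → Val
    eqv prop               p q = equiv p q
    eqv (base form)        p q = equiv p q
    eqv (base (ambient _)) _ _ = ⋂ []
    eqv (σ ⇒ τ)            f g = ⋂ (map (λ a → eqv τ (proj₁ f a) (proj₁ g a)) (elems σ))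

    eqv-intro : ∀ σ {w a b} → Eq σ w a b → w ⊩ eqv σ a b
    eqv-intro prop               e = equiv-intro e
    eqv-intro (base form)        e = equiv-intro e
    eqv-intro (base (ambient _)) e = ⋂-intro λ ()
    eqv-intro (σ ⇒ τ)            e = ⋂-map-intro λ {a} _ → eqv-intro τ (e a)

    eqv-elim : ∀ σ {w a b} → w ⊩ eqv σ a b → Eq σ w a b
    eqv-elim prop               h = equiv-elim h
    eqv-elim (base form)        h = equiv-elim h
    eqv-elim (base (ambient _)) h = tt
    eqv-elim (σ ⇒ τ) {a = f} {g} h a with elems-complete σ a
    ... | e , e∈ , a≈e = Eq-trans τ (proj₂ f a≈e) (Eq-trans τ
      (eqv-elim τ (⋂-map-elim (λ a → eqv τ (proj₁ f a) (proj₁ g a)) h e∈))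
      (Eq-sym τ (proj₂ g a≈e)))

    eqv-congˡ : ∀ σ {w a b c} → Eq σ w a b → w ⊩ eqv σ a c ≋ eqv σ b c
    eqv-congˡ σ e w≤v =
      (λ h → eqv-intro σ (Eq-trans σ (Eq-sym σ (Eq-mono σ w≤v e)) (eqv-elim σ h))) ,
      (λ h → eqv-intro σ (Eq-trans σ (Eq-mono σ w≤v e) (eqv-elim σ h)))

    -- A function is recovered from the table pairing each listed argument with the listed
    -- representative of its value: `covers` finds a row for any argument, and `agrees` uses
    -- extensionality of `f` to show that every applicable row has the right value.
    elems-complete : ∀ σ a → ∃ λ e → e ∈ elems σ × (∀ {w} → Eq σ w a e)
    elems-complete prop p with vals-complete p
    ... | q , q∈ , e = q , q∈ , λ _ → e
    elems-complete (base form) p with vals-complete p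
    ... | q , q∈ , e = q , q∈ , λ _ → e
    elems-complete (base (ambient _)) tt = tt , here refl , tt
    elems-complete (σ ⇒ τ) (f , f-ext) =
      fromTable t , ∈-map⁺ fromTable (∈-tables r (elems σ) r∈) ,
      λ {w} a → Eq-sym τ (glue-Eq τ t (f a) (agrees a) (covers a))
      where
      r : El σ → El τ
      r a = proj₁ (elems-complete τ (f a))

      r∈ : ∀ a → r a ∈ elems τ
      r∈ a = proj₁ (proj₂ (elems-complete τ (f a)))

      t : List (El σ × El τ)
      t = map (λ a → a , r a) (elems σ)

      agrees : ∀ a {w x} → x ∈ t → ∀ {v} → w ≤ v → v ⊩ eqv σ a (proj₁ x) →
               Eq τ v (proj₂ x) (f a)
      agrees a x∈ _ h with ∈-map⁻ (λ a → a , r a) x∈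
      ... | e , _ , refl = Eq-trans τ
        (Eq-sym τ (proj₂ (proj₂ (elems-complete τ (f e)))))
        (f-ext (Eq-sym σ (eqv-elim σ h)))

      covers : ∀ a {w} → ∃ λ x → x ∈ t × w ⊩ eqv σ a (proj₁ x)
      covers a with elems-complete σ a
      ... | e , e∈ , a≈e = (e , r e) , ∈-map⁺ (λ a → a , r a) e∈ , eqv-intro σ a≈e

  -- Denotations of constants and terms, renaming and substitution.

  forAll : ∀ σ → El ((σ ⇒ prop) ⇒ prop)
  forAll σ = (λ f → ⋂ (map (proj₁ f) (elems σ))) , λ e → ⋂-map-cong (elems σ) e

  forAll-intro : ∀ σ (f : El (σ ⇒ prop)) {w} → (∀ a → w ⊩ proj₁ f a) → w ⊩ proj₁ (forAll σ) f
  forAll-intro σ f h = ⋂-map-intro λ {a} _ → h a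

  forAll-elim : ∀ σ (f : El (σ ⇒ prop)) {w} → w ⊩ proj₁ (forAll σ) f → ∀ a → w ⊩ proj₁ f a
  forAll-elim σ f h a with elems-complete σ a
  ... | e , e∈ , a≈e = proj₂ (proj₂ f a≈e ≤-refl) (⋂-map-elim (proj₁ f) h e∈)

  -- Serves the connectives on `form` as well, since `El` and `Eq` compute to the same at `form` and
  -- `prop`.
  binary : (f : Val → Val → Val) →
           (∀ {w p p′ q q′} → w ⊩ p ≋ p′ → w ⊩ q ≋ q′ → w ⊩ f p q ≋ f p′ q′) →
           El (prop ⇒ prop ⇒ prop)
  binary f f-cong =
    (λ p → f p , f-cong ≋-refl) , λ e q → f-cong e ≋-refl

  ⟦_⟧ᶜ : ∀ {σ} → Const σ → El σ
  ⟦ ⊥ᶜ ⟧ᶜ    = ⋂ vals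
  ⟦ &ᶜ ⟧ᶜ    = binary _⊓_ ⊓-cong
  ⟦ ∨ᶜ ⟧ᶜ    = binary _⊔_ ⊔-cong
  ⟦ ⊃ᶜ ⟧ᶜ    = binary _⇛_ ⇛-cong
  ⟦ trueᶜ ⟧ᶜ = id , id
  -- The axioms do not mention ambient constants, so any inhabitant will do.
  ⟦ ambientᶜ {σ} _ ⟧ᶜ = default (mapType ambient σ)

  Env : Ctx → Set
  Env Γ = ∀ {σ} → Var Γ σ → El σ

  infixl 5 _▸_

  _▸_ : ∀ {Γ τ} → Env Γ → El τ → Env (τ ∷ Γ)
  (ρ ▸ a) new     = a
  (ρ ▸ a) (old x) = ρ x

  EqEnv : ∀ {Γ} → World → Env Γ → Env Γ → Set
  EqEnv {Γ} w ρ ρ′ = ∀ {σ} (x : Var Γ σ) → Eq σ w (ρ x) (ρ′ x)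

  ▸-cong : ∀ {Γ τ w} {ρ ρ′ : Env Γ} (a : El τ) → EqEnv w ρ ρ′ →
           EqEnv w (_▸_ {τ = τ} ρ a) (_▸_ {τ = τ} ρ′ a)
  ▸-cong {τ = τ} a e new     = Eq-refl τ
  ▸-cong         a e (old x) = e x

  mutual
    ⟦_⟧ : ∀ {Γ σ} → Tm Γ σ → Env Γ → El σ
    ⟦ var x ⟧ ρ = ρ x
    ⟦ con c ⟧ ρ = ⟦ c ⟧ᶜ
    ⟦ imp ⟧   ρ = binary _⇛_ ⇛-cong
    ⟦ all σ ⟧ ρ = forAll σ
    ⟦ eq σ ⟧  ρ =
      (λ a → eqv σ a , λ {w} {b} {c} e w≤v →
        (λ h → eqv-intro σ (Eq-trans σ (eqv-elim σ h) (Eq-mono σ w≤v e))) ,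
        (λ h → eqv-intro σ (Eq-trans σ (eqv-elim σ h) (Eq-sym σ (Eq-mono σ w≤v e))))) ,
      λ e b → eqv-congˡ σ e
    ⟦ ƛ {σ} {τ} a ⟧ ρ =
      (λ x → ⟦ a ⟧ (ρ ▸ x)) ,
      (λ e → ⟦⟧-cong a λ { new → e ; (old {σ = σ} x) → Eq-refl σ })
    ⟦ f · a ⟧ ρ = proj₁ (⟦ f ⟧ ρ) (⟦ a ⟧ ρ)

    ⟦⟧-cong : ∀ {Γ σ} (a : Tm Γ σ) {ρ ρ′ : Env Γ} {w} → EqEnv w ρ ρ′ →
              Eq σ w (⟦ a ⟧ ρ) (⟦ a ⟧ ρ′)
    ⟦⟧-cong (var x) e = e x
    ⟦⟧-cong {σ = σ} (con c) e = Eq-refl σ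
    ⟦⟧-cong {σ = σ} imp     {ρ} e = Eq-refl σ {a = ⟦ imp ⟧ ρ}
    ⟦⟧-cong {σ = σ} (all τ) {ρ} e = Eq-refl σ {a = ⟦ all τ ⟧ ρ}
    ⟦⟧-cong {σ = σ} (eq τ)  {ρ} e = Eq-refl σ {a = ⟦ eq τ ⟧ ρ}
    ⟦⟧-cong (ƛ a)   e = λ x → ⟦⟧-cong a (▸-cong x e)
    ⟦⟧-cong {σ = σ} (f · a) {ρ} {ρ′} e =
      Eq-trans σ (⟦⟧-cong f e (⟦ a ⟧ ρ)) (proj₂ (⟦ f ⟧ ρ′) (⟦⟧-cong a e))

  -- Stated up to `Eq`: denotations of abstractions are functions paired with congruence proofs, so
  -- `_≡_` would call for function extensionality.
  ⟦rename⟧ : ∀ {Γ Δ σ} (r : Ren Γ Δ) (a : Tm Γ σ) (ρ : Env Δ) {w} →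
             Eq σ w (⟦ rename r a ⟧ ρ) (⟦ a ⟧ (λ x → ρ (r x)))
  ⟦rename⟧ {σ = σ} r (var x) ρ = Eq-refl σ
  ⟦rename⟧ {σ = σ} r (con c) ρ = Eq-refl σ
  ⟦rename⟧ {σ = σ} r imp     ρ = Eq-refl σ {a = ⟦ imp ⟧ ρ}
  ⟦rename⟧ {σ = σ} r (all τ) ρ = Eq-refl σ {a = ⟦ all τ ⟧ ρ}
  ⟦rename⟧ {σ = σ} r (eq τ)  ρ = Eq-refl σ {a = ⟦ eq τ ⟧ ρ}
  ⟦rename⟧ {σ = _ ⇒ τ} r (ƛ a) ρ x = Eq-trans τ (⟦rename⟧ (liftRen r) a (ρ ▸ x))
    (⟦⟧-cong a λ { {σ} new → Eq-refl σ ; {σ} (old y) → Eq-refl σ })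
  ⟦rename⟧ {σ = σ} r (f · a) ρ = Eq-trans σ (⟦rename⟧ r f ρ (⟦ rename r a ⟧ ρ))
    (proj₂ (⟦ f ⟧ (λ x → ρ (r x))) (⟦rename⟧ r a ρ))

  ⟦subst⟧ : ∀ {Γ Δ σ} (s : Sub Γ Δ) (a : Tm Γ σ) (ρ : Env Δ) {w} →
            Eq σ w (⟦ subst s a ⟧ ρ) (⟦ a ⟧ (λ x → ⟦ s x ⟧ ρ))
  ⟦subst⟧ {σ = σ} s (var x) ρ = Eq-refl σ
  ⟦subst⟧ {σ = σ} s (con c) ρ = Eq-refl σ
  ⟦subst⟧ {σ = σ} s imp     ρ = Eq-refl σ {a = ⟦ imp ⟧ ρ}
  ⟦subst⟧ {σ = σ} s (all τ) ρ = Eq-refl σ {a = ⟦ all τ ⟧ ρ}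
  ⟦subst⟧ {σ = σ} s (eq τ)  ρ = Eq-refl σ {a = ⟦ eq τ ⟧ ρ}
  ⟦subst⟧ {σ = _ ⇒ τ} s (ƛ a) ρ x = Eq-trans τ (⟦subst⟧ (liftSub s) a (ρ ▸ x))
    (⟦⟧-cong a λ { {σ} new → Eq-refl σ ; (old y) → ⟦rename⟧ old (s y) (ρ ▸ x) })
  ⟦subst⟧ {σ = σ} s (f · a) ρ = Eq-trans σ (⟦subst⟧ s f ρ (⟦ subst s a ⟧ ρ))
    (proj₂ (⟦ f ⟧ (λ x → ⟦ s x ⟧ ρ)) (⟦subst⟧ s a ρ))

  ⟦[]⟧ : ∀ {Γ σ τ} (a : Tm (τ ∷ Γ) σ) (b : Tm Γ τ) (ρ : Env Γ) {w} →
         Eq σ w (⟦ a [ b ] ⟧ ρ) (⟦ a ⟧ (ρ ▸ ⟦ b ⟧ ρ))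
  ⟦[]⟧ {σ = σ} a b ρ = Eq-trans σ (⟦subst⟧ (single b) a ρ)
    (⟦⟧-cong a λ { {σ} new → Eq-refl σ ; {σ} (old x) → Eq-refl σ })

  -- Soundness of the meta-logic in every frame.

  axiom-sound : ∀ {Γ} {φ : Formula Γ} → Axiom φ → (ρ : Env Γ) → ∀ {w} → w ⊩ ⟦ φ ⟧ ρ
  axiom-sound &I  ρ = ⋂-map-intro λ _ → ⋂-map-intro λ _ → ⇛-intro λ _ x → ⇛-intro λ w≤v y →
      ⊓-intro (⊩-mono w≤v x) y
  axiom-sound &E₁ ρ = ⋂-map-intro λ _ → ⋂-map-intro λ _ → ⇛-intro λ _ → ⊓-elim₁
  axiom-sound &E₂ ρ = ⋂-map-intro λ _ → ⋂-map-intro λ _ → ⇛-intro λ _ → ⊓-elim₂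
  axiom-sound ∨I₁ ρ = ⋂-map-intro λ _ → ⋂-map-intro λ _ → ⇛-intro λ _ → ⊔-intro₁
  axiom-sound ∨I₂ ρ = ⋂-map-intro λ _ → ⋂-map-intro λ _ → ⇛-intro λ _ → ⊔-intro₂
  axiom-sound ∨E  ρ = ⋂-map-intro λ _ → ⋂-map-intro λ _ → ⋂-map-intro λ {c} _ →
      ⇛-intro λ _ x → ⇛-intro λ w≤v f → ⇛-intro λ v≤u g →
      ⊔-elim c (⊩-mono (≤-trans w≤v v≤u) x)
        (λ u≤t → ⇛-elim (⊩-mono (≤-trans v≤u u≤t) f))
        (λ u≤t → ⇛-elim (⊩-mono u≤t g))
  -- `True` denotes the identity, and `_⊃_` and `_⟹_` denote the same operation `_⇛_`, so both sides
  -- of the axiom coincide.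
  axiom-sound ⊃I  ρ = ⋂-map-intro λ _ → ⋂-map-intro λ _ → ⇛-intro λ _ → id
  axiom-sound ⊃E  ρ = ⋂-map-intro λ _ → ⋂-map-intro λ _ → ⇛-intro λ _ → id
  axiom-sound ⊥E  ρ = ⋂-map-intro λ {a} _ → ⇛-intro λ _ → ⋂vals-elim a

  infix 4 _⊩⋆_at_

  _⊩⋆_at_ : ∀ {Γ} → World → List (Formula Γ) → Env Γ → Set
  w ⊩⋆ Φ at ρ = ∀ {φ} → φ ∈ Φ → w ⊩ ⟦ φ ⟧ ρ

  ⊩⋆-∷ : ∀ {Γ w v φ} {Φ : List (Formula Γ)} {ρ : Env Γ} → w ≤ v →
         w ⊩⋆ Φ at ρ → v ⊩ ⟦ φ ⟧ ρ → v ⊩⋆ φ ∷ Φ at ρ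
  ⊩⋆-∷ w≤v h x (here refl) = x
  ⊩⋆-∷ w≤v h x (there φ∈)  = ⊩-mono w≤v (h φ∈)

  ⊩⋆-weaken : ∀ {Γ σ w} {Φ : List (Formula Γ)} {ρ : Env Γ} (a : El σ) →
              w ⊩⋆ Φ at ρ → w ⊩⋆ map weaken Φ at (_▸_ {τ = σ} ρ a)
  ⊩⋆-weaken {σ = σ} {ρ = ρ} a h φ∈ with ∈-map⁻ weaken φ∈
  ... | ψ , ψ∈ , refl = proj₂ (⟦rename⟧ old ψ (_▸_ {τ = σ} ρ a) ≤-refl) (h ψ∈)

  sound : ∀ {Γ} {Φ : List (Formula Γ)} {φ} → Φ ⊢ φ → (ρ : Env Γ) → ∀ {w} →
          w ⊩⋆ Φ at ρ → w ⊩ ⟦ φ ⟧ ρ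
  sound (axiom a) ρ h = axiom-sound a ρ
  sound (hyp φ∈)  ρ h = h φ∈
  sound (⇒I d)    ρ h = ⇛-intro λ w≤v x → sound d ρ (⊩⋆-∷ w≤v h x)
  sound (⇒E d e)  ρ h = ⇛-elim (sound d ρ h) (sound e ρ h)
  sound (⋀I {σ} {φ} d) ρ h =
    forAll-intro σ (⟦ ƛ φ ⟧ ρ) λ a → sound d (_▸_ {τ = σ} ρ a) (⊩⋆-weaken {σ = σ} {ρ = ρ} a h)
  sound (⋀E {σ} {φ} d b) ρ h =
    proj₂ (⟦[]⟧ φ b ρ ≤-refl) (forAll-elim σ (⟦ ƛ φ ⟧ ρ) (sound d ρ h) (⟦ b ⟧ ρ))
  sound (≡-refl {σ}) ρ h = eqv-intro σ (Eq-refl σ)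
  sound (≡-sym {σ} d) ρ h = eqv-intro σ (Eq-sym σ (eqv-elim σ (sound d ρ h)))
  sound (≡-trans {σ} d e) ρ h =
    eqv-intro σ (Eq-trans σ (eqv-elim σ (sound d ρ h)) (eqv-elim σ (sound e ρ h)))
  sound (β {τ = τ} {a} {b}) ρ h = eqv-intro τ (Eq-sym τ (⟦[]⟧ a b ρ))
  sound (ext {σ} {τ} {f} {g} d) ρ h = eqv-intro (σ ⇒ τ) {a = ⟦ f ⟧ ρ} {⟦ g ⟧ ρ} λ a → let ρ′ = _▸_ {τ = σ} ρ a in
    Eq-trans τ (Eq-sym τ (⟦rename⟧ old f ρ′ a))
      (Eq-trans τ (eqv-elim τ (sound d ρ′ (⊩⋆-weaken {σ = σ} {ρ = ρ} a h))) (⟦rename⟧ old g ρ′ a))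
  sound (abstraction {σ} {τ} {a} {b} d) ρ h = eqv-intro (σ ⇒ τ) {a = ⟦ ƛ a ⟧ ρ} {⟦ ƛ b ⟧ ρ} λ a →
    eqv-elim τ (sound d (_▸_ {τ = σ} ρ a) (⊩⋆-weaken {σ = σ} {ρ = ρ} a h))
  sound (combination {σ} {τ} {f} {g} {a} {b} d e) ρ h = eqv-intro τ
    (Eq-trans τ (eqv-elim (σ ⇒ τ) {a = ⟦ f ⟧ ρ} {⟦ g ⟧ ρ} (sound d ρ h) (⟦ a ⟧ ρ))
      (proj₂ (⟦ g ⟧ ρ) (eqv-elim σ (sound e ρ h))))
  sound (equivI d e) ρ h = equiv-intro λ w≤v →
    (λ x → sound d ρ (⊩⋆-∷ w≤v h x)) , (λ y → sound e ρ (⊩⋆-∷ w≤v h y))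
  sound (equivE d e) ρ h = proj₁ (equiv-elim (sound d ρ h) ≤-refl) (sound e ρ h)

-- Weakening in IPL, subformulas and finite enumerations.

weakening : ∀ {Γ Δ A} → Γ ⊆ˡ Δ → Γ IPL.⊢ A → Δ IPL.⊢ A
weakening s (IPL.hyp A∈)    = IPL.hyp (s A∈)
weakening s (IPL.&I d e)    = IPL.&I (weakening s d) (weakening s e)
weakening s (IPL.&E₁ d)     = IPL.&E₁ (weakening s d)
weakening s (IPL.&E₂ d)     = IPL.&E₂ (weakening s d)
weakening s (IPL.∨I₁ d)     = IPL.∨I₁ (weakening s d)
weakening s (IPL.∨I₂ d)     = IPL.∨I₂ (weakening s d)
weakening s (IPL.∨E d e f)  =
  IPL.∨E (weakening s d) (weakening (∷⁺ʳ _ s) e) (weakening (∷⁺ʳ _ s) f)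
weakening s (IPL.⊃I d)      = IPL.⊃I (weakening (∷⁺ʳ _ s) d)
weakening s (IPL.⊃E d e)    = IPL.⊃E (weakening s d) (weakening s e)
weakening s (IPL.⊥E d)      = IPL.⊥E (weakening s d)

-- Split in two so that `subformulas A` exposes its head `A` even for a variable `A`; membership of
-- `A` is then `here refl`.
subformulas : IPL.Formula → List IPL.Formula
immediate   : IPL.Formula → List IPL.Formula
subformulas A = A ∷ immediate A
immediate (IPL.atom n) = []
immediate IPL.⊥        = []
immediate (A IPL.& B)  = subformulas A ++ subformulas B
immediate (A IPL.∨ B)  = subformulas A ++ subformulas B
immediate (A IPL.⊃ B)  = subformulas A ++ subformulas B

atom≟ : ∀ n A → Dec (IPL.atom n ≡ A)
atom≟ n (IPL.atom m) = map′ (cong IPL.atom) (λ { refl → refl }) (n ≟ⁿ m)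
atom≟ n IPL.⊥        = no λ ()
atom≟ n (A IPL.& B)  = no λ ()
atom≟ n (A IPL.∨ B)  = no λ ()
atom≟ n (A IPL.⊃ B)  = no λ ()

sublists : {A : Set} → List A → List (List A)
sublists []       = [] ∷ []
sublists (x ∷ xs) = map (x ∷_) (sublists xs) ++ sublists xs

filter∈sublists : {A : Set} {P : A → Set} (P? : ∀ x → Dec (P x)) (xs : List A) →
                  filter P? xs ∈ sublists xs
filter∈sublists P? []       = here refl
filter∈sublists P? (x ∷ xs) with does (P? x)
... | true  = ∈-++⁺ˡ (∈-map⁺ (x ∷_) (filter∈sublists P? xs))
... | false = ∈-++⁺ʳ (map (x ∷_) (sublists xs)) (filter∈sublists P? xs)

subsets : ∀ n → List (Subset n)
subsets zero    = [] ∷ []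
subsets (suc n) = cartesianProductWith _∷_ (true ∷ false ∷ []) (subsets n)

∈-subsets : ∀ {n} (p : Subset n) → p ∈ subsets n
∈-subsets []          = here refl
∈-subsets (true  ∷ p) = ∈-cartesianProductWith⁺ _∷_ {xs = true ∷ false ∷ []} (here refl) (∈-subsets p)
∈-subsets (false ∷ p) = ∈-cartesianProductWith⁺ _∷_ {xs = true ∷ false ∷ []} (there (here refl)) (∈-subsets p)

∪-least : ∀ {n} {p q r : Subset n} → p ⊆ r → q ⊆ r → p ∪ q ⊆ r
∪-least {p = p} {q} f g x∈ = [ f , g ]′ (x∈p∪q⁻ p q x∈)

∪-∪ : ∀ {n} {p q r : Subset n} → (p ∪ q) ∪ r ⊆ p ∪ (q ∪ r)
∪-∪ {p = p} {q} {r} i∈ = transport (_ Subset.∈_) (∪-assoc p q r) i∈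

-- Provability in IPL is not assumed decidable.  As in Friedman's A-translation, a
-- goal R takes the place of absurdity: relative to R, any finite collection of
-- propositions may be taken to be decided.
module Relative (R : Set) where

  ‖_‖ : Set → Set
  ‖ P ‖ = (P → R) → R

  Decided : Set → Set
  Decided P = P ⊎ (P → R)

  return : {P : Set} → P → ‖ P ‖
  return p k = k p

  mapᵣ : {P Q : Set} → (P → Q) → ‖ P ‖ → ‖ Q ‖
  mapᵣ f m k = m (k ∘ f)

  map₂ᵣ : {P Q O : Set} → (P → Q → O) → ‖ P ‖ → ‖ Q ‖ → ‖ O ‖
  map₂ᵣ f m l k = m λ p → l λ q → k (f p q)

  decided : {P : Set} → ‖ Decided P ‖
  decided k = k (inj₂ (k ∘ inj₁))

  allDecided : {A : Set} (P : A → Set) (xs : List A) → ‖ All (Decided ∘ P) xs ‖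
  allDecided P []       = return []
  allDecided P (x ∷ xs) = map₂ᵣ _∷_ decided (allDecided P xs)

  Decided-‖‖ : {P : Set} → Decided P → Decided ‖ P ‖
  Decided-‖‖ (inj₁ p) = inj₁ (return p)
  Decided-‖‖ (inj₂ n) = inj₂ λ m → m n

  Decided-All : {A : Set} {P : A → Set} → (∀ x → Decided (P x)) →
                ∀ xs → Decided (All P xs)
  Decided-All d []       = inj₁ []
  Decided-All d (x ∷ xs) with d x | Decided-All d xs
  ... | inj₁ p | inj₁ ps = inj₁ (p ∷ ps)
  ... | inj₂ n | _       = inj₂ λ { (p ∷ _) → n p }
  ... | _      | inj₂ n  = inj₂ λ { (_ ∷ ps) → n ps }

  holds : {P : Set} → Decided P → Bool
  holds = [ const true , const false ]′

  holds⁻ : {P : Set} (d : Decided P) → T (holds d) → P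
  holds⁻ (inj₁ p) _ = p

  -- The conclusion is only relative to `R`, because a proof of `P` against a recorded refutation
  -- produces `R`, not absurdity.
  holds⁺ : {P : Set} (d : Decided P) → P → ‖ T (holds d) ‖
  holds⁺ (inj₁ _) _ = return tt
  holds⁺ (inj₂ n) p = λ _ → n p

-- Contexts given by sets of subformulas.

module Contexts (As S : List IPL.Formula) where

  n : ℕ
  n = length S

  -- A world is a set of positions in `S`, so worlds are finitely many and have unions. A formula
  -- may stand at several positions; derivability does not distinguish them.
  context : Subset n → List IPL.Formula
  context w = As ++ map (lookup S) (filter (_∈ˢ? w) (allFin n))

  ∈-context⁺ : ∀ {w i} → i Subset.∈ w → lookup S i ∈ context w
  ∈-context⁺ {w} {i} i∈ =
    ∈-++⁺ʳ As (∈-map⁺ (lookup S) (∈-filter⁺ (_∈ˢ? w) (∈-allFin i) i∈))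

  ∈-context⁻ : ∀ w {A} → A ∈ context w → A ∈ As ⊎ ∃ λ i → i Subset.∈ w × A ≡ lookup S i
  ∈-context⁻ w A∈ with ∈-++⁻ As A∈
  ... | inj₁ A∈As = inj₁ A∈As
  ... | inj₂ A∈w with ∈-map⁻ (lookup S) A∈w
  ... | i , i∈ , A≡ = inj₂ (i , proj₂ (∈-filter⁻ (_∈ˢ? w) {xs = allFin n} i∈) , A≡)

  context-mono : ∀ {w v} → w ⊆ v → context w ⊆ˡ context v
  context-mono {w} w⊆v A∈ with ∈-context⁻ w A∈
  ... | inj₁ A∈As            = ∈-++⁺ˡ A∈As
  ... | inj₂ (i , i∈ , refl) = ∈-context⁺ (w⊆v i∈)

  context-⊥ : context Subset.⊥ ⊆ˡ As
  context-⊥ A∈ with ∈-context⁻ Subset.⊥ A∈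
  ... | inj₁ A∈As        = A∈As
  ... | inj₂ (i , i∈ , _) = absurd (∉⊥ i∈)

  context-∪ : ∀ {w v i} → v ⊆ ⁅ i ⁆ ∪ w → context v ⊆ˡ lookup S i ∷ context w
  context-∪ {w} {v} {i} v⊆ A∈ with ∈-context⁻ v A∈
  ... | inj₁ A∈As = there (∈-++⁺ˡ A∈As)
  ... | inj₂ (j , j∈ , refl) with x∈p∪q⁻ ⁅ i ⁆ w (v⊆ j∈)
  ... | inj₁ j∈i = here (cong (lookup S) (x∈⁅y⁆⇒x≡y i j∈i))
  ... | inj₂ j∈w = there (∈-context⁺ j∈w)

  infix 3 _⊢ᵢ_

  _⊢ᵢ_ : Subset n → Fin n → Set
  w ⊢ᵢ i = context w IPL.⊢ lookup S i

  ⊢ᵢ-mono : ∀ {w v i} → w ⊆ v → w ⊢ᵢ i → v ⊢ᵢ i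
  ⊢ᵢ-mono w⊆v = weakening (context-mono w⊆v)

-- The canonical frame of sequents.

module Canonical (As S : List IPL.Formula) (R : Set) where
  open Relative R
  open Contexts As S

  -- (Δ , i) stands for the set of worlds w in which the i-th formula of S is
  -- derivable after adding Δ, and a list stands for an intersection of such sets.
  Sequent : Set
  Sequent = Subset n × Fin n

  sequents : List Sequent
  sequents = cartesianProduct (subsets n) (allFin n)

  _∈?_ : (x : Sequent) (p : List Sequent) → Dec (x ∈ p)
  _∈?_ = mem? (≡-dec (≡-decᵛ _≟ᵇ_) _≟ᶠ_)

  infix 4 _⊩₁_ _⊩ᶜ_

  -- Derivability is taken relative to `R`, so that a proof of forcing may appeal to decisions that
  -- hold only relative to `R`.
  _⊩₁_ : Subset n → Sequent → Set
  w ⊩₁ (Δ , i) = ‖ w ∪ Δ ⊢ᵢ i ‖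

  _⊩ᶜ_ : Subset n → List Sequent → Set
  w ⊩ᶜ p = All (w ⊩₁_) p

  ⊩₁-mono : ∀ {w v} x → w ⊆ v → w ⊩₁ x → v ⊩₁ x
  ⊩₁-mono {w} {v} (Δ , i) w⊆v =
    mapᵣ (⊢ᵢ-mono (∪-least (λ i∈ → p⊆p∪q Δ (w⊆v i∈)) (q⊆p∪q v Δ)))

  module _ (⊢ᵢ-decided : ∀ w i → Decided (w ⊢ᵢ i)) where

    ⊩ᶜ-decided : ∀ p w → Decided (w ⊩ᶜ p)
    ⊩ᶜ-decided p w = Decided-All (λ { (Δ , i) → Decided-‖‖ (⊢ᵢ-decided (w ∪ Δ) i) }) p

    extent : List Sequent → List (Subset n)
    extent p = filter (T? ∘ holds ∘ ⊩ᶜ-decided p) (subsets n)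

    act : Subset n → Sequent → Sequent
    act v (Δ , i) = v ∪ Δ , i

    infixr 6 _⇛ᶜ_

    -- By monotonicity, `w` forces the implication exactly when `w ∪ v` forces `q` for every world
    -- `v` forcing `p`. Moving `v` into the added set `Δ` turns this into a finite list of sequents.
    _⇛ᶜ_ : List Sequent → List Sequent → List Sequent
    p ⇛ᶜ q = cartesianProductWith act (extent p) q

    ⇛ᶜ-intro : ∀ {w p q} → (∀ {v} → w ⊆ v → v ⊩ᶜ p → v ⊩ᶜ q) → w ⊩ᶜ p ⇛ᶜ q
    ⇛ᶜ-intro {w} {p} {q} h = All.tabulate go
      where
      go : ∀ {x} → x ∈ p ⇛ᶜ q → w ⊩₁ x
      go x∈ with ∈-cartesianProductWith⁻ act (extent p) q x∈
      ... | v , (Δ , i) , v∈ , y∈ , refl =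
        mapᵣ (⊢ᵢ-mono (∪-least (∪-least (p⊆p∪q (v ∪ Δ)) (λ j → q⊆p∪q w _ (p⊆p∪q Δ j)))
                               (λ j → q⊆p∪q w _ (q⊆p∪q v Δ j))))
          (All.lookup (h (p⊆p∪q v) (All.map (λ {x} → ⊩₁-mono x (q⊆p∪q w v)) v⊩p)) y∈)
        where
        v⊩p : v ⊩ᶜ p
        v⊩p = holds⁻ (⊩ᶜ-decided p v)
          (proj₂ (∈-filter⁻ (T? ∘ holds ∘ ⊩ᶜ-decided p) {xs = subsets n} v∈))

    -- Take `v` to be `w` itself, which lies in the extent of `p` relative to `R`; then
    -- `w ∪ (w ∪ Δ)` collapses to `w ∪ Δ`.
    ⇛ᶜ-elim : ∀ {w p q} → w ⊩ᶜ p ⇛ᶜ q → w ⊩ᶜ p → w ⊩ᶜ q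
    ⇛ᶜ-elim {w} {p} {q} h w⊩p = All.tabulate λ { {Δ , i} x∈ k →
      holds⁺ (⊩ᶜ-decided p w) w⊩p λ t →
        All.lookup h (∈-cartesianProductWith⁺ act
          (∈-filter⁺ (T? ∘ holds ∘ ⊩ᶜ-decided p) (∈-subsets w) t) x∈)
        (k ∘ ⊢ᵢ-mono (∪-least (p⊆p∪q Δ) id)) }

    frame : Frame
    frame = record
      { World   = Subset n
      ; _≤_     = _⊆_
      ; ≤-refl  = id
      ; ≤-trans = λ u⊆v v⊆w i∈ → v⊆w (u⊆v i∈)
      ; Val     = List Sequent
      ; _⊩_     = _⊩ᶜ_
      ; ⊩-mono  = λ w⊆v → All.map (λ {x} → ⊩₁-mono x w⊆v)
      ; _⇛_     = _⇛ᶜ_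
      ; ⇛-intro = ⇛ᶜ-intro
      ; ⇛-elim  = ⇛ᶜ-elim
      ; ⋂       = concat
      ; ⋂-intro = λ {w} {ps} h → All.tabulate λ x∈ →
          let _ , x∈p , p∈ = ∈-concat⁻′ ps x∈ in All.lookup (h p∈) x∈p
      ; ⋂-elim  = λ h p∈ → All.tabulate λ x∈ → All.lookup h (∈-concat⁺′ x∈ p∈)
      ; vals    = sublists sequents
      ; vals-complete = λ p →
          -- Filtering the list of all sequents by membership in `p` normalises order and repetition
          -- while keeping the same set of sequents.
          filter (_∈? p) sequents , filter∈sublists (_∈? p) sequents ,
          (λ h → All.tabulate λ x∈ →
            All.lookup h (proj₂ (∈-filter⁻ (_∈? p) {xs = sequents} x∈))) ,
          (λ h → All.tabulate λ { {Δ , i} x∈ → All.lookup h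
            (∈-filter⁺ (_∈? p) (∈-cartesianProduct⁺ (∈-subsets Δ) (∈-allFin i)) x∈) })
      }

    -- Denotation of subformulas agrees with derivability.

    open FrameProperties frame

    -- The set of worlds deriving `A`, as a value: the instance at which the second-order encodings
    -- of `_∨_` and `⊥` are used.
    generator : ∀ {A} → A ∈ S → Val
    generator A∈ = (Subset.⊥ , index A∈) ∷ []

    generator-elim : ∀ {w A} (A∈ : A ∈ S) → w ⊩ generator A∈ → ‖ context w IPL.⊢ A ‖
    generator-elim {w} A∈ (m ∷ []) =
      transport (λ A → ‖ context w IPL.⊢ A ‖) (sym (lookup-index A∈))
        (mapᵣ (⊢ᵢ-mono (∪-least id (absurd ∘ ∉⊥))) m)

    generator-intro : ∀ {w A} (A∈ : A ∈ S) → ‖ context w IPL.⊢ A ‖ → w ⊩ generator A∈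
    generator-intro {w} A∈ m =
      mapᵣ (⊢ᵢ-mono (p⊆p∪q Subset.⊥))
        (transport (λ A → ‖ context w IPL.⊢ A ‖) (lookup-index A∈) m) ∷ []

    adjoin : ∀ {A} → A ∈ S → Subset n → Subset n
    adjoin A∈ w = ⁅ index A∈ ⁆ ∪ w

    ⊆-adjoin : ∀ {A w} (A∈ : A ∈ S) → w ⊆ adjoin A∈ w
    ⊆-adjoin {w = w} A∈ = q⊆p∪q ⁅ index A∈ ⁆ w

    adjoin-hyp : ∀ {A w} (A∈ : A ∈ S) → context (adjoin A∈ w) IPL.⊢ A
    adjoin-hyp {w = w} A∈ = IPL.hyp (transport (_∈ context (adjoin A∈ w)) (sym (lookup-index A∈))
      (∈-context⁺ (p⊆p∪q w (x∈⁅x⁆ (index A∈)))))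

    adjoin-discharge : ∀ {A C w v} (A∈ : A ∈ S) → v ⊆ adjoin A∈ w →
                       context v IPL.⊢ C → A ∷ context w IPL.⊢ C
    adjoin-discharge {A} {w = w} {v} A∈ v⊆ =
      weakening (transport (λ B → context v ⊆ˡ B ∷ context w) (sym (lookup-index A∈)) (context-∪ v⊆))

    -- Here the shape of the values matters. Each member of `c` is derivability of some formula
    -- after adding `Δ`, so `IPL.∨E` applies with that formula as conclusion; an arbitrary upward
    -- closed set of worlds need not allow this.
    cases : ∀ {A B w} (A∈ : A ∈ S) (B∈ : B ∈ S) (c : Val) → ‖ context w IPL.⊢ A IPL.∨ B ‖ →
            adjoin A∈ w ⊩ c → adjoin B∈ w ⊩ c → w ⊩ c
    cases {w = w} A∈ B∈ c m h k = All.tabulate λ { {Δ , i} x∈ l →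
      m λ d → All.lookup h x∈ λ e → All.lookup k x∈ λ f →
      l (IPL.∨E (weakening (context-mono (p⊆p∪q Δ)) d)
          (adjoin-discharge A∈ (∪-∪ {p = ⁅ index A∈ ⁆} {w} {Δ}) e)
          (adjoin-discharge B∈ (∪-∪ {p = ⁅ index B∈ ⁆} {w} {Δ}) f)) }

    module _ (Sig : Signature) where
      open MIPL Sig using (⌜_⌝; form; name; _⊢_)
      open Interpretation frame Sig

      -- The meet over all positions of the atom in `S`, so that no proof of occurrence is required;
      -- for an absent atom it is the empty meet.
      atomVal : ℕ → Val
      atomVal m = map (Subset.⊥ ,_) (filter (λ i → atom≟ m (lookup S i)) (allFin n))

      ρ₀ : Env []
      ρ₀ (name {base form} m) = atomVal m
      ρ₀ (name {σ} _)         = default σ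

      Represents : IPL.Formula → Set
      Represents A = ∀ {w} → (w ⊩ ⟦ ⌜ A ⌝ ⟧ ρ₀ → ‖ context w IPL.⊢ A ‖) ×
                             (‖ context w IPL.⊢ A ‖ → w ⊩ ⟦ ⌜ A ⌝ ⟧ ρ₀)

      -- The truth lemma, by induction on `A`. Closure of `S` under subformulas makes the generators
      -- and the adjoined worlds available.
      represents : ∀ A → subformulas A ⊆ˡ S → Represents A
      represents-immediate : ∀ A B → subformulas A ++ subformulas B ⊆ˡ S →
                             Represents A × Represents B

      represents-immediate A B s =
        represents A (λ x∈ → s (∈-++⁺ˡ x∈)) ,
        represents B (λ x∈ → s (∈-++⁺ʳ (subformulas A) x∈))

      represents (IPL.atom m) s =
        (λ h → generator-elim m∈ (All.lookup h
          (∈-map⁺ (Subset.⊥ ,_) (∈-filter⁺ isAtom? (∈-allFin _) (lookup-index m∈))) ∷ [])) ,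
        (λ p → All.tabulate (go p))
        where
        m∈ : IPL.atom m ∈ S
        m∈ = s (here refl)

        isAtom? : ∀ i → Dec (IPL.atom m ≡ lookup S i)
        isAtom? i = atom≟ m (lookup S i)

        go : ∀ {w} → ‖ context w IPL.⊢ IPL.atom m ‖ → ∀ {x} → x ∈ atomVal m → w ⊩₁ x
        go {w} p x∈ with ∈-map⁻ (Subset.⊥ ,_) x∈
        ... | i , i∈ , refl = mapᵣ
          (λ d → ⊢ᵢ-mono (p⊆p∪q Subset.⊥) (transport (context w IPL.⊢_)
            (proj₂ (∈-filter⁻ isAtom? {xs = allFin n} i∈)) d)) p
      represents IPL.⊥ s =
        -- `⊥` denotes the meet of all values, hence lies below the generator of `⊥` itself.
        (λ h → generator-elim (s (here refl)) (⋂vals-elim (generator (s (here refl))) h)) ,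
        (λ p → ⋂-intro {ps = vals} λ _ → All.tabulate λ { {Δ , i} _ →
          mapᵣ (⊢ᵢ-mono (p⊆p∪q Δ) ∘ IPL.⊥E) p })
      represents (A IPL.& B) s with represents-immediate A B (s ∘ there)
      ... | a , b =
        (λ h → map₂ᵣ IPL.&I (proj₁ a (⊓-elim₁ {p = ⟦ ⌜ A ⌝ ⟧ ρ₀} h))
                         (proj₁ b (⊓-elim₂ {p = ⟦ ⌜ A ⌝ ⟧ ρ₀} h))) ,
        (λ p → ⊓-intro (proj₂ a (mapᵣ IPL.&E₁ p)) (proj₂ b (mapᵣ IPL.&E₂ p)))
      represents (A IPL.∨ B) s with represents-immediate A B (s ∘ there)
      ... | a , b =
        -- The second-order disjunction is eliminated into the generator of the disjunction itself.
        (λ h → generator-elim A∨B∈ (⊔-elim {p = ⟦ ⌜ A ⌝ ⟧ ρ₀} {⟦ ⌜ B ⌝ ⟧ ρ₀} (generator A∨B∈) h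
          (λ _ x → generator-intro A∨B∈ (mapᵣ IPL.∨I₁ (proj₁ a x)))
          (λ _ y → generator-intro A∨B∈ (mapᵣ IPL.∨I₂ (proj₁ b y))))) ,
        (λ p → ⊔-intro {p = ⟦ ⌜ A ⌝ ⟧ ρ₀} {⟦ ⌜ B ⌝ ⟧ ρ₀} λ c → ⇛-intro λ w≤v f → ⇛-intro λ v≤u g →
          cases A∈ B∈ c (mapᵣ (weakening (context-mono (v≤u ∘ w≤v))) p)
            (⇛-elim (⊩-mono (⊆-adjoin A∈ ∘ v≤u) f) (proj₂ a (return (adjoin-hyp A∈))))
            (⇛-elim (⊩-mono (⊆-adjoin B∈) g) (proj₂ b (return (adjoin-hyp B∈)))))
        where
        A∨B∈ : A IPL.∨ B ∈ S
        A∨B∈ = s (here refl)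

        A∈ : A ∈ S
        A∈ = s (there (here refl))

        B∈ : B ∈ S
        B∈ = s (there (∈-++⁺ʳ (subformulas A) (here refl)))
      represents (A IPL.⊃ B) s with represents-immediate A B (s ∘ there)
      ... | a , b =
        -- The implication is tested at the world with `A` adjoined, where `A` is a hypothesis;
        -- `IPL.⊃I` then discharges it.
        (λ h → mapᵣ (IPL.⊃I ∘ adjoin-discharge A∈ id)
          (proj₁ b (⇛-elim (⊩-mono (⊆-adjoin A∈) h) (proj₂ a (return (adjoin-hyp A∈)))))) ,
        (λ p → ⇛-intro λ w≤v x →
          proj₂ b (map₂ᵣ IPL.⊃E (mapᵣ (weakening (context-mono w≤v)) p) (proj₁ a x)))
        where
        A∈ : A ∈ S
        A∈ = s (there (here refl))

      conservative : ∀ B → (∀ {A} → A ∈ B ∷ As → subformulas A ⊆ˡ S) →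
                     map (MIPL.⟦_⟧ Sig) As ⊢ MIPL.⟦_⟧ Sig B → ‖ As IPL.⊢ B ‖
      conservative B s d = mapᵣ (weakening context-⊥)
        (proj₁ (represents B (s (here refl))) (sound d ρ₀ {Subset.⊥} assumptions))
        where
        assumptions : Subset.⊥ ⊩⋆ map (MIPL.⟦_⟧ Sig) As at ρ₀
        assumptions φ∈ with ∈-map⁻ (MIPL.⟦_⟧ Sig) φ∈
        ... | A , A∈ , refl =
          proj₂ (represents A (s (there A∈))) (return (IPL.hyp (∈-++⁺ˡ A∈)))

theorem2 : (S : Signature) (As : List IPL.Formula) (B : IPL.Formula) →
    (let open MIPL S in map ⟦_⟧ As ⊢ ⟦ B ⟧) → As IPL.⊢ B
-- The goal `R` is the desired derivability itself, so the final continuation is `id`. The list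
-- `sequents` is reused as the list of all pairs of a world and a position, whose finitely many
-- derivability statements may be taken as decided.
theorem2 Sig As B d = allDecided (λ x → proj₁ x ⊢ᵢ proj₂ x) sequents λ dec →
  conservative (λ w i → All.lookup dec (∈-cartesianProduct⁺ (∈-subsets w) (∈-allFin i))) Sig B
    (λ A∈ x∈ → ∈-concat⁺′ x∈ (∈-map⁺ subformulas A∈)) d id
  where
  S : List IPL.Formula
  S = concatMap subformulas (B ∷ As)

  open Contexts As S
  open Canonical As S (As IPL.⊢ B)
  open Relative (As IPL.⊢ B)
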